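{- Let $P$ be a $d$-dimensional $k\times\cdots\times k$ permutation matrix or a tuple permutation matrix generated by such a permutation matrix. Then $I(P,d)\ge d(k-1)$. Furthermore, if $P$ is the $d$-dimensional $k\times\cdots\times k$ identity matrix, then $I(P,d)=S(P,d)=d(k-1)$.
   Context: A $d$-dimensional $n_1\times\cdots\times n_d$ zero-one matrix is an array $A=(a_{i_1,\ldots,i_d})$, $1\le i_\ell\le n_\ell$, with entries in $\{0,1\}$. A submatrix is obtained by selecting, for each $\ell$, a set of values of the $\ell$-th coordinate (keeping the order). $A$ contains a $d$-dimensional zero-one matrix $B$ if some submatrix of $A$ can be transformed into $B$ by changing any number of ones to zeros; otherwise $A$ avoids $B$. $f(n,B,d)$ denotes the maximum number of ones in a $d$-dimensional $n\times\cdots\times n$ zero-one matrix that avoids $B$, and $$I(P,d)=\liminf_{n\to\infty}\frac{f(n,P,d)}{n^{d-1}},\qquad S(P,d)=\limsup_{n\to\infty}\frac{f(n,P,d)}{n^{d-1}}.$$ An $\ell$-cross section is the set of all entries having a fixed value of the $\ell$-th coordinate. A $d$-dimensional $k\times\cdots\times k$ zero-one matrix is a permutation matrix if each of its $\ell$-cross sections contains exactly one nonzero entry, for every $\ell=1,\ldots,d$. The identity matrix has $p_{i_1,\ldots,i_d}=1$ if $i_1=\cdots=i_d$ and $0$ otherwise. $R^{k_1,\ldots,k_d}$ is the $k_1\times\cdots\times k_d$ matrix of all ones, and the Kronecker product $M\otimes N$ is obtained by replacing each $1$-entry of $M$ by a copy of $N$ and each $0$-entry of $M$ by a zero matrix of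 the same size as $N$. A tuple permutation matrix generated by a permutation matrix $P'$ is a matrix $P'\otimes R^{k_1,\ldots,k_d}$ in which exactly one of $k_1,\ldots,k_d$ is larger than $1$ and the rest equal $1$. -}

module Defs where

open import Data.Bool.Base using (Bool; true; false; _∧_; if_then_else_)
  renaming (_≤_ to _≤ᵇ_)
open import Data.Bool.Properties using ()
  renaming (_≤?_ to _≤ᵇ?_; ≤-reflexive to ≤ᵇ-reflexive; ≤-trans to ≤ᵇ-trans)
open import Data.Fin.Base using (Fin; zero; suc; toℕ; quotient; remainder)
import Data.Fin.Properties as Fin
open import Data.Integer.Base using (+_)
open import Data.List.Base as List using (List; []; _∷_; [_]; filter; cartesianProductWith)
open import Data.List.Extrema.Nat using (max; v≤max⁺; max≤v⁺)
open import Data.List.Membership.Propositional using (_∈_; find; lose)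
open import Data.List.Membership.Propositional.Properties
  using (∈-filter⁺; ∈-filter⁻; ∈-map⁺; ∈-map⁻)
open import Data.List.Relation.Unary.All as ListAll using ()
open import Data.List.Relation.Unary.Any as Any using (Any; here; there)
import Data.List.Relation.Unary.Any.Properties as Any
open import Data.Nat.Base using (ℕ; zero; suc; NonZero; _*_; _∸_; _^_; _≤_; z≤n; _>_)
open import Data.Nat.Properties as ℕ using (m^n≢0; +-0-commutativeMonoid)
open import Algebra.Properties.CommutativeMonoid.Sum +-0-commutativeMonoid
  using (sum; sum-cong-≗)
open import Data.Product using (Σ; ∃; ∃!; _×_; _,_; proj₁; proj₂)
open import Data.Rational.Base as ℚ using (ℚ; _/_)
open import Data.Sum.Base using (inj₁; inj₂; [_,_]′)
open import Data.Vec.Base using (Vec; []; _∷_; lookup; replicate; zipWith)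
import Data.Vec.Functional as Vector
open import Data.Vec.Relation.Binary.Pointwise.Inductive using (Pointwise; []; _∷_)
open import Data.Vec.Relation.Unary.All using (All; []; _∷_)
open import Data.Vec.Relation.Unary.All.Properties using (lookup⁺)
open import Function.Base using (_∘_; const)
open import Function.Bundles using (_⇔_)
open import Level using (0ℓ)
open import Relation.Binary.PropositionalEquality using (_≡_; _≢_; _≗_; refl; sym; cong)
open import Relation.Nullary using (¬_; Dec; yes; no; ⌊_⌋; ¬?)
open import Relation.Nullary.Decidable using (map′; _⊎-dec_)
open import Relation.Unary using (Pred; Decidable)

private
  variable
    d k n : ℕ
    ks ms ns : Vec ℕ d

-- An index is a tuple with ℓ-th coordinate in Fin (lookup ns ℓ).  It is
-- first-order data, so that matrices need no function extensionality.

Index : Vec ℕ d → Set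
Index = All Fin

coord : Index ns → (ℓ : Fin d) → Fin (lookup ns ℓ)
coord = lookup⁺

Matrix : Vec ℕ d → Set
Matrix ns = Index ns → Bool

Cubical : (d n : ℕ) → Set
Cubical d n = Matrix (replicate d n)

ones : Matrix ns → ℕ
ones {ns = []}     A = if A [] then 1 else 0
ones {ns = n ∷ ns} A = sum λ (i : Fin n) → ones λ is → A (i ∷ is)

-- k ⊑ n is the type of ways to select k of n values: each of the n
-- values, in order, is either kept or skipped.

infix 4 _⊑_

data _⊑_ : ℕ → ℕ → Set where
  done : 0 ⊑ 0
  keep : k ⊑ n → suc k ⊑ suc n
  skip : k ⊑ n → k ⊑ suc n

select : k ⊑ n → Fin k → Fin n
select (keep s) zero    = zero
select (keep s) (suc j) = suc (select s j)
select (skip s) j       = suc (select s j)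

Selection : Vec ℕ d → Vec ℕ d → Set
Selection = Pointwise _⊑_

selectIndex : Selection ks ns → Index ks → Index ns
selectIndex []       []       = []
selectIndex (s ∷ ss) (i ∷ is) = select s i ∷ selectIndex ss is

submatrix : Selection ks ns → Matrix ns → Matrix ks
submatrix s A = A ∘ selectIndex s

-- B arises from C by changing ones to zeros.

infix 4 _≼_

_≼_ : Matrix ns → Matrix ns → Set
B ≼ C = ∀ i → B i ≤ᵇ C i

Contains : {ns ks : Vec ℕ d} → Matrix ns → Matrix ks → Set
Contains {ns = ns} {ks} A B = Σ (Selection ks ns) λ s → B ≼ submatrix s A

Avoids : {ns ks : Vec ℕ d} → Matrix ns → Matrix ks → Set
Avoids A B = ¬ Contains A B

allIndices? : {P : Pred (Index ns) 0ℓ} → Decidable P → Dec (∀ i → P i)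
allIndices? {ns = []}     P? = map′ (λ p → λ { [] → p }) (λ p → p []) (P? [])
allIndices? {ns = n ∷ ns} P? =
  map′ (λ p → λ { (i ∷ is) → p i is }) (λ p i is → p (i ∷ is))
       (Fin.all? λ i → allIndices? λ is → P? (i ∷ is))

any⊑? : {P : Pred (k ⊑ n) 0ℓ} → Decidable P → Dec (∃ P)
any⊑? {zero}  {zero}  P? = map′ (done ,_) (λ { (done , p) → p }) (P? done)
any⊑? {zero}  {suc n} P? =
  map′ (λ { (s , p) → skip s , p }) (λ { (skip s , p) → s , p }) (any⊑? (P? ∘ skip))
any⊑? {suc k} {zero}  P? = no λ { (() , _) }
any⊑? {suc k} {suc n} P? =
  map′ [ (λ { (s , p) → keep s , p }) , (λ { (s , p) → skip s , p }) ]′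
       (λ { (keep s , p) → inj₁ (s , p) ; (skip s , p) → inj₂ (s , p) })
       (any⊑? (P? ∘ keep) ⊎-dec any⊑? (P? ∘ skip))

anySelection? : {P : Pred (Selection ks ns) 0ℓ} → Decidable P → Dec (∃ P)
anySelection? {ks = []}     {ns = []}     P? = map′ ([] ,_) (λ { ([] , p) → p }) (P? [])
anySelection? {ks = k ∷ ks} {ns = n ∷ ns} P? =
  map′ (λ { (s , ss , p) → s ∷ ss , p }) (λ { (s ∷ ss , p) → s , ss , p })
       (any⊑? λ s → anySelection? λ ss → P? (s ∷ ss))

avoids? : (B : Matrix ks) → Decidable (λ (A : Matrix ns) → Avoids A B)
avoids? B A = ¬? (anySelection? λ s → allIndices? λ i → B i ≤ᵇ? submatrix s A i)

functions : {X : Set} (n : ℕ) → List X → List (Fin n → X)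
functions zero    xs = [ Vector.[] ]
functions (suc n) xs = cartesianProductWith Vector._∷_ xs (functions n xs)

stack : (Fin n → Matrix ns) → Matrix (n ∷ ns)
stack As (i ∷ is) = As i is

-- Every matrix occurs in this list, up to pointwise equality.

matrices : (ns : Vec ℕ d) → List (Matrix ns)
matrices []       = const false ∷ const true ∷ []
matrices (n ∷ ns) = List.map stack (functions n (matrices ns))

-- f n B is the maximum number of ones over the matrices avoiding B; the
-- value is 0 if there are none, as can only happen if B has no ones.  See
-- f-upper and f-least below.

f : ℕ → {ks : Vec ℕ d} → Matrix ks → ℕ
f {d} n B = max 0 (List.map ones (filter (avoids? B) (matrices (replicate d n))))

private
  functions-complete : {X : Set} {xs : List X} {_≈_ : X → X → Set} →
    (∀ x → Any (x ≈_) xs) →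
    ∀ n (g : Fin n → X) → Any (λ h → ∀ i → g i ≈ h i) (functions n xs)
  functions-complete c zero    g = here λ ()
  functions-complete c (suc n) g =
    Any.cartesianProductWith⁺ Vector._∷_
      (λ p q → λ { zero → p ; (suc i) → q i })
      (c (g zero)) (functions-complete c n (g ∘ suc))

matrices-complete : (A : Matrix ns) → Any (A ≗_) (matrices ns)
matrices-complete {ns = []} A with A [] in eq
... | false = here λ { [] → eq }
... | true  = there (here λ { [] → eq })
matrices-complete {ns = n ∷ ns} A =
  Any.map⁺ (Any.map (λ p → λ { (i ∷ is) → p i is })
    (functions-complete matrices-complete n λ i is → A (i ∷ is)))

ones-cong : {A B : Matrix ns} → A ≗ B → ones A ≡ ones B
ones-cong {ns = []}     A≗B = cong (if_then 1 else 0) (A≗B [])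
ones-cong {ns = n ∷ ns} A≗B = sum-cong-≗ λ i → ones-cong λ is → A≗B (i ∷ is)

avoids-cong : {A A′ : Matrix ns} {B : Matrix ks} → A ≗ A′ → Avoids A B → Avoids A′ B
avoids-cong A≗A′ avoids (s , le) =
  avoids (s , λ i → ≤ᵇ-trans (le i) (≤ᵇ-reflexive (sym (A≗A′ (selectIndex s i)))))

f-upper : (B : Matrix ks) (A : Cubical d n) → Avoids A B → ones A ≤ f n B
f-upper B A avoids with find (matrices-complete A)
... | A′ , A′∈ , A≗A′ =
  v≤max⁺ 0 _ (inj₂ (lose
    (∈-map⁺ ones (∈-filter⁺ (avoids? B) A′∈ (avoids-cong A≗A′ avoids)))
    (ℕ.≤-reflexive (ones-cong A≗A′))))

f-least : (B : Matrix ks) {m : ℕ} →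
          (∀ (A : Cubical d n) → Avoids A B → ones A ≤ m) → f n B ≤ m
f-least {d = d} {n = n} B {m} bound = max≤v⁺ z≤n (ListAll.tabulate below)
  where
  below : ∀ {v} → v ∈ List.map ones (filter (avoids? B) (matrices (replicate d n))) →
          v ≤ m
  below v∈ with ∈-map⁻ ones v∈
  ... | A , A∈ , refl =
    bound A (proj₂ (∈-filter⁻ (avoids? B) {xs = matrices (replicate d n)} A∈))

-- The library has no real numbers.  A lower limit is represented by its
-- lower cut, the set of rationals strictly below it, and an upper limit
-- by its upper cut, the set of rationals strictly above it; infinite
-- values are allowed.

LowerReal UpperReal : Set₁
LowerReal = Pred ℚ 0ℓ
UpperReal = Pred ℚ 0ℓ

Sequence : Set
Sequence = (n : ℕ) .{{_ : NonZero n}} → ℚ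

liminf : Sequence → LowerReal
liminf a q = ∃ λ r → q ℚ.< r × ∃ λ N → ∀ n .{{_ : NonZero n}} → N ≤ n → r ℚ.≤ a n

limsup : Sequence → UpperReal
limsup a q = ∃ λ r → r ℚ.< q × ∃ λ N → ∀ n .{{_ : NonZero n}} → N ≤ n → a n ℚ.≤ r

infix 4 _≥ᴸ_ _≈ᴸ_ _≈ᵁ_

_≥ᴸ_ : LowerReal → ℚ → Set
L ≥ᴸ x = ∀ q → q ℚ.< x → L q

_≈ᴸ_ : LowerReal → ℚ → Set
L ≈ᴸ x = ∀ q → L q ⇔ q ℚ.< x

_≈ᵁ_ : UpperReal → ℚ → Set
U ≈ᵁ x = ∀ q → U q ⇔ x ℚ.< q

density : {ks : Vec ℕ d} → Matrix ks → Sequence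
density {d} P n = _/_ (+ f n P) (n ^ (d ∸ 1)) {{m^n≢0 n (d ∸ 1)}}

I : {ks : Vec ℕ d} → Matrix ks → LowerReal
I P = liminf (density P)

S : {ks : Vec ℕ d} → Matrix ks → UpperReal
S P = limsup (density P)

IsPermutation : Cubical d k → Set
IsPermutation {d} {k} P =
  ∀ (ℓ : Fin d) (c : Fin (lookup (replicate d k) ℓ)) →
  ∃! _≡_ λ i → coord i ℓ ≡ c × P i ≡ true

-- The coordinates have types which are equal only propositionally, so
-- they are compared as natural numbers.

identity : (d k : ℕ) → Cubical d k
identity d k i =
  ⌊ (Fin.all? λ ℓ → Fin.all? λ m → toℕ (coord i ℓ) ℕ.≟ toℕ (coord i m)) ⌋

R : (ks : Vec ℕ d) → Matrix ks
R ks _ = true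

quotients : Index (zipWith _*_ ms ns) → Index ms
quotients {ms = []}     {[]}     []       = []
quotients {ms = m ∷ ms} {n ∷ ns} (i ∷ is) = quotient {m} n i ∷ quotients {ns = ns} is

remainders : Index (zipWith _*_ ms ns) → Index ns
remainders {ms = []}     {[]}     []       = []
remainders {ms = m ∷ ms} {n ∷ ns} (i ∷ is) = remainder {m} n i ∷ remainders {ms = ms} is

-- The entry at i lies in the block given by the quotients of the
-- coordinates of i by ns, at the position given by the remainders.

infixr 7 _⊗_

_⊗_ : Matrix ms → Matrix ns → Matrix (zipWith _*_ ms ns)
_⊗_ {ms = ms} {ns = ns} M N i = M (quotients {ns = ns} i) ∧ N (remainders {ms = ms} i)

ExactlyOneLargerThan1 : Vec ℕ d → Set
ExactlyOneLargerThan1 ks =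
  ∃ λ ℓ → lookup ks ℓ > 1 × (∀ m → m ≢ ℓ → lookup ks m ≡ 1)

data IsTuplePermutation {d} (k : ℕ) : {ns : Vec ℕ d} → Matrix ns → Set where
  generated : (P′ : Cubical d k) (ks : Vec ℕ d) →
              IsPermutation P′ → ExactlyOneLargerThan1 ks →
              {P : Matrix (zipWith _*_ (replicate d k) ks)} →
              P ≗ P′ ⊗ R ks → IsTuplePermutation k P

{-# OPTIONS --safe #-}

-- A selection of k_ℓ of n values moves p_ℓ to a position between p_ℓ and
-- p_ℓ + n − k_ℓ.  Hence, if P has a one at p, the matrix that is zero exactly on
-- the box of these positions avoids P, which gives
-- f(n, P, d) ≥ n^d − (n − k + 1)^d ~ d(k − 1)n^(d−1).  For the identity matrix,
-- at most d n^(d−1) diagonals in direction (1, …, 1) cover the cube, and each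
-- has at most k − 1 ones of an avoiding matrix, so f(n, P, d) ≤ d(k − 1)n^(d−1).
-- The sum over the diagonals is carried out by telescoping over the slices of
-- the first coordinate: shifting a function bounded by m along the diagonal
-- loses at most m for each index on the surface of the slice.

module Submission where

open import Defs
open import Data.Bool.Base using (Bool; true; false; not; _∧_; if_then_else_)
  renaming (_≤_ to _≤ᵇ_)
import Data.Bool.Properties as Bool
open import Data.Fin.Base using (Fin; zero; suc; toℕ; fromℕ<; combine)
import Data.Fin.Properties as Fin
open import Data.Integer.Base as ℤ using (+_; -[1+_])
import Data.Integer.Properties as ℤ
open import Data.Nat.Base
  using (ℕ; zero; suc; NonZero; _+_; _*_; _∸_; _^_; _≤_; _<_;
         z≤n; s≤s; z<s; s<s⁻¹; s≤s⁻¹)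
open import Data.Nat.Properties
open import Data.Nat.Tactic.RingSolver using (solve-∀)
open import Algebra.Properties.CommutativeMonoid.Sum +-0-commutativeMonoid
  using (sum; sum-cong-≗; ∑-distrib-+)
open import Data.Product.Base using (Σ; ∃; _×_; _,_; proj₁; proj₂)
open import Data.Rational.Base as ℚ using (ℚ; mkℚ; _/_; ↥_; ↧_)
import Data.Rational.Properties as ℚ
import Data.Rational.Unnormalised.Base as ℚᵘ
import Data.Rational.Unnormalised.Properties as ℚᵘ
open import Data.Sum.Base using (_⊎_; inj₁; inj₂)
open import Data.Vec.Base using (Vec; []; _∷_; lookup; replicate; zipWith)
import Data.Vec.Properties as Vec
open import Data.Vec.Relation.Binary.Pointwise.Inductive using ([]; _∷_)
open import Data.Vec.Relation.Unary.All using ([]; _∷_)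
open import Data.Vec.Relation.Unary.All.Properties using (lookup⁻)
open import Function.Base using (_∘_)
open import Function.Bundles using (mk⇔)
open import Relation.Binary.PropositionalEquality
open import Relation.Nullary using (¬_; Dec; yes; no; ⌊_⌋; contradiction)

private
  variable
    d k m n : ℕ
    ks ns : Vec ℕ d

-- Sums over indices and the number of ones

sum-mono : {g h : Fin n → ℕ} → (∀ i → g i ≤ h i) → sum g ≤ sum h
sum-mono {zero}  g≤h = z≤n
sum-mono {suc n} g≤h = +-mono-≤ (g≤h zero) (sum-mono (g≤h ∘ suc))

sum-const : ∀ n c → sum {n} (λ _ → c) ≡ n * c
sum-const zero    c = refl
sum-const (suc n) c = cong (_+_ c) (sum-const n c)

indicator : Bool → ℕ
indicator b = if b then 1 else 0

total : (Index ns → ℕ) → ℕ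
total {ns = []}     g = g []
total {ns = n ∷ ns} g = sum λ (i : Fin n) → total λ is → g (i ∷ is)

ones≡total : (A : Matrix ns) → ones A ≡ total (indicator ∘ A)
ones≡total {ns = []}     A = refl
ones≡total {ns = n ∷ ns} A = sum-cong-≗ λ i → ones≡total λ is → A (i ∷ is)

total-cong : {g h : Index ns → ℕ} → g ≗ h → total g ≡ total h
total-cong {ns = []}     g≗h = g≗h []
total-cong {ns = n ∷ ns} g≗h = sum-cong-≗ λ i → total-cong λ is → g≗h (i ∷ is)

total-mono : {g h : Index ns → ℕ} → (∀ i → g i ≤ h i) → total g ≤ total h
total-mono {ns = []}     g≤h = g≤h []
total-mono {ns = n ∷ ns} g≤h = sum-mono λ i → total-mono λ is → g≤h (i ∷ is)

total-+ : (g h : Index ns → ℕ) → total (λ i → g i + h i) ≡ total g + total h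
total-+ {ns = []}     g h = refl
total-+ {ns = n ∷ ns} g h = trans
  (sum-cong-≗ λ i → total-+ (λ is → g (i ∷ is)) (λ is → h (i ∷ is)))
  (∑-distrib-+ {n} _ _)

volume : Vec ℕ d → ℕ
volume []       = 1
volume (n ∷ ns) = n * volume ns

volume-replicate : ∀ d n → volume (replicate d n) ≡ n ^ d
volume-replicate zero    n = refl
volume-replicate (suc d) n = cong (n *_) (volume-replicate d n)

total-const : (ns : Vec ℕ d) (c : ℕ) → total {ns = ns} (λ _ → c) ≡ c * volume ns
total-const []       c = sym (*-identityʳ c)
total-const (n ∷ ns) c = begin
  sum {n} (λ _ → total {ns = ns} (λ _ → c)) ≡⟨ sum-const n _ ⟩
  n * total {ns = ns} (λ _ → c)             ≡⟨ cong (n *_) (total-const ns c) ⟩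
  n * (c * volume ns)                       ≡⟨ lemma n c (volume ns) ⟩
  c * (n * volume ns)                       ∎
  where
  open ≡-Reasoning
  lemma : ∀ n c v → n * (c * v) ≡ c * (n * v)
  lemma = solve-∀

total-bound : {g : Index ns → ℕ} → (∀ i → g i ≤ m) → total g ≤ m * volume ns
total-bound {ns = ns} {m = m} g≤m = ≤-trans (total-mono g≤m) (≤-reflexive (total-const ns m))

ones-false : (ns : Vec ℕ d) → ones {ns = ns} (λ _ → false) ≡ 0
ones-false ns = trans (ones≡total {ns = ns} _) (total-const ns 0)

ones-complement : (A : Matrix ns) → ones A + ones (not ∘ A) ≡ volume ns
ones-complement {ns = ns} A = begin
  ones A + ones (not ∘ A)
    ≡⟨ cong₂ _+_ (ones≡total A) (ones≡total (not ∘ A)) ⟩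
  total (indicator ∘ A) + total (indicator ∘ not ∘ A)
    ≡⟨ total-+ (indicator ∘ A) (indicator ∘ not ∘ A) ⟨
  total (λ i → indicator (A i) + indicator (not (A i)))
    ≡⟨ total-cong (λ i → lemma (A i)) ⟩
  total {ns = ns} (λ _ → 1)
    ≡⟨ total-const ns 1 ⟩
  1 * volume ns
    ≡⟨ *-identityˡ _ ⟩
  volume ns ∎
  where
  open ≡-Reasoning
  lemma : ∀ b → indicator b + indicator (not b) ≡ 1
  lemma false = refl
  lemma true  = refl

-- Lower bound

-- The indicator of `a ≤ i < a + w`, defined by structural recursion so that its ones are counted by
-- the same recursion.
interval : ℕ → ℕ → ℕ → Bool
interval zero    zero    _       = false
interval zero    (suc w) zero    = true
interval zero    (suc w) (suc i) = interval zero w i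
interval (suc a) w       zero    = false
interval (suc a) w       (suc i) = interval a w i

interval-true : ∀ {a i} w → a ≤ i → i < a + w → interval a w i ≡ true
interval-true {zero}  {zero}  (suc w) a≤i i<a+w = refl
interval-true {zero}  {suc i} (suc w) a≤i i<a+w = interval-true w z≤n (s<s⁻¹ i<a+w)
interval-true {suc a} {suc i} w       a≤i i<a+w = interval-true w (s≤s⁻¹ a≤i) (s<s⁻¹ i<a+w)

-- Only an inequality, since the interval may reach beyond `n`.
ones-interval : ∀ n a w (A : Matrix ns) →
  sum (λ (i : Fin n) → ones λ is → interval a w (toℕ i) ∧ A is) ≤ w * ones A
ones-interval zero    a       w       A = z≤n
ones-interval {ns = ns} (suc n) zero    zero    A
  rewrite ones-false ns = ≤-reflexive (trans (sum-const n 0) (*-zeroʳ n))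
ones-interval (suc n) zero    (suc w) A = +-monoʳ-≤ (ones A) (ones-interval n zero w A)
ones-interval {ns = ns} (suc n) (suc a) w       A
  rewrite ones-false ns = ones-interval n a w A

-- The box with lowest corner `p` and side `w`, cut off at the sides `ns`.
box : {ks : Vec ℕ d} → Index ks → ℕ → (ns : Vec ℕ d) → Matrix ns
box {ks = []}     []       w []       _        = true
box {ks = k ∷ ks} (p ∷ ps) w (n ∷ ns) (i ∷ is) =
  interval (toℕ p) w (toℕ i) ∧ box ps w ns is

ones-box : {ks : Vec ℕ d} (p : Index ks) (w : ℕ) (ns : Vec ℕ d) → ones (box p w ns) ≤ w ^ d
ones-box {ks = []}     []       w []       = ≤-refl
ones-box {ks = k ∷ ks} (p ∷ ps) w (n ∷ ns) =
  ≤-trans (ones-interval n (toℕ p) w (box ps w ns)) (*-monoʳ-≤ w (ones-box ps w ns))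

select-≥ : (s : k ⊑ n) (p : Fin k) → toℕ p ≤ toℕ (select s p)
select-≥ (keep s) zero    = z≤n
select-≥ (keep s) (suc p) = s≤s (select-≥ s p)
select-≥ (skip s) p       = m≤n⇒m≤1+n (select-≥ s p)

⊑⇒≤ : k ⊑ n → k ≤ n
⊑⇒≤ done     = z≤n
⊑⇒≤ (keep s) = s≤s (⊑⇒≤ s)
⊑⇒≤ (skip s) = m≤n⇒m≤1+n (⊑⇒≤ s)

-- The `k − p` values selected from `p` on need as many places at or above the image of `p`. The
-- additive form avoids truncated subtraction.
select-≤ : (s : k ⊑ n) (p : Fin k) → toℕ (select s p) + k ≤ toℕ p + n
select-≤             (keep s) zero    = ⊑⇒≤ (keep s)
select-≤ {suc k} {suc n} (keep s) (suc p) = s≤s (begin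
  toℕ (select s p) + suc k   ≡⟨ +-suc _ k ⟩
  suc (toℕ (select s p) + k) ≤⟨ s≤s (select-≤ s p) ⟩
  suc (toℕ p + n)            ≡⟨ +-suc _ n ⟨
  toℕ p + suc n              ∎)
  where open ≤-Reasoning
select-≤ {k} {suc n} (skip s) p       = ≤-trans (s≤s (select-≤ s p)) (≤-reflexive (sym (+-suc (toℕ p) n)))

-- Assuming `m < k` instead of `k = m + 1` lets one `m` serve all sides of a matrix that is not
-- cubical.
select-interval : m < k → (s : k ⊑ n) (p : Fin k) →
  interval (toℕ p) (n ∸ m) (toℕ (select s p)) ≡ true
select-interval {m} {k} {n} m<k s p = interval-true (n ∸ m) (select-≥ s p) (begin
  suc (toℕ (select s p))             ≡⟨ m+n∸n≡m _ m ⟨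
  suc (toℕ (select s p)) + m ∸ m     ≡⟨ cong (_∸ m) (+-suc (toℕ (select s p)) m) ⟨
  toℕ (select s p) + suc m ∸ m       ≤⟨ ∸-monoˡ-≤ m (+-monoʳ-≤ (toℕ (select s p)) m<k) ⟩
  toℕ (select s p) + k ∸ m           ≤⟨ ∸-monoˡ-≤ m (select-≤ s p) ⟩
  toℕ p + n ∸ m                      ≡⟨ +-∸-assoc (toℕ p) (≤-trans (<⇒≤ m<k) (⊑⇒≤ s)) ⟩
  toℕ p + (n ∸ m)                    ∎)
  where open ≤-Reasoning

select-box : {ks : Vec ℕ d} → (∀ ℓ → m < lookup ks ℓ) → (s : Selection ks (replicate d n)) (p : Index ks) →
  box p (n ∸ m) (replicate d n) (selectIndex s p) ≡ true
select-box {ks = []}     m<ks []       []       = refl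
select-box {ks = k ∷ ks} m<ks (s ∷ ss) (p ∷ ps)
  rewrite select-interval (m<ks zero) s p = select-box (m<ks ∘ suc) ss ps

-- The witness is the complement of the box that every selection maps `p` into.
f-lower : {ks : Vec ℕ d} (P : Matrix ks) (p : Index ks) → P p ≡ true →
  (∀ ℓ → m < lookup ks ℓ) → ∀ n → n ^ d ≤ f n P + (n ∸ m) ^ d
f-lower {d} {m} P p Pp m<ks n = begin
  n ^ d                     ≡⟨ volume-replicate d n ⟨
  volume (replicate d n)    ≡⟨ ones-complement B ⟨
  ones B + ones (not ∘ B)   ≡⟨ +-comm (ones B) _ ⟩
  ones (not ∘ B) + ones B   ≤⟨ +-mono-≤ (f-upper P (not ∘ B) avoids) (ones-box p (n ∸ m) (replicate d n)) ⟩
  f n P + (n ∸ m) ^ d       ∎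
  where
  open ≤-Reasoning
  B = box p (n ∸ m) (replicate d n)
  avoids : Avoids (not ∘ B) P
  -- The one of `P` at `p` would have to lie over a zero of the complement.
  avoids (s , le) with () ← subst₂ _≤ᵇ_ Pp (cong not (select-box m<ks s p)) (le p)

-- Estimates for powers

-- The first two terms of the binomial expansion. In the induction step, the term of order `m * m`
-- is added to complete the product.
^-bernoulli : ∀ w m e → w ^ suc e + suc e * m * w ^ e ≤ (w + m) ^ suc e
^-bernoulli w m zero    = ≤-reflexive (lemma w m)
  where
  lemma : ∀ w m → w * 1 + (m + 0) * 1 ≡ (w + m) * 1
  lemma = solve-∀
^-bernoulli w m (suc e) = begin
  w * (w * w ^ e) + (m + (m + e * m)) * (w * w ^ e)
    ≤⟨ m≤m+n _ (m * ((m + e * m) * w ^ e)) ⟩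
  w * (w * w ^ e) + (m + (m + e * m)) * (w * w ^ e) + m * ((m + e * m) * w ^ e)
    ≡⟨ lemma w m (e * m) (w ^ e) ⟩
  (w + m) * (w * w ^ e + (m + e * m) * w ^ e)
    ≤⟨ *-monoʳ-≤ (w + m) (^-bernoulli w m e) ⟩
  (w + m) * (w + m) ^ suc e ∎
  where
  open ≤-Reasoning
  lemma : ∀ w m c x → w * (w * x) + (m + (m + c)) * (w * x) + m * ((m + c) * x) ≡ (w + m) * (w * x + (m + c) * x)
  lemma = solve-∀

-- A mean value estimate for the `e`-th power, multiplied by `w + m` so that no exponent `e ∸ 1`
-- occurs.
^-lipschitz : ∀ w m e → (w + m) ^ e * (w + m) ≤ w ^ e * (w + m) + e * m * (w + m) ^ e
^-lipschitz w m zero    = ≤-reflexive (sym (+-identityʳ _))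
^-lipschitz w m (suc e) = begin
  (w + m) * x * (w + m)                                    ≡⟨ lemma₁ (w + m) x ⟩
  (w + m) * (x * (w + m))                                  ≤⟨ *-monoʳ-≤ (w + m) (^-lipschitz w m e) ⟩
  (w + m) * (y * (w + m) + e * m * x)                      ≡⟨ lemma₂ w m x y (e * m) ⟩
  w * y * (w + m) + (m * (y * (w + m)) + e * m * ((w + m) * x))
    ≤⟨ +-monoʳ-≤ (w * y * (w + m)) (+-monoˡ-≤ _ (*-monoʳ-≤ m (*-monoˡ-≤ (w + m) (^-monoˡ-≤ e (m≤m+n w m))))) ⟩
  w * y * (w + m) + (m * (x * (w + m)) + e * m * ((w + m) * x)) ≡⟨ lemma₃ w m x y (e * m) ⟩
  w * y * (w + m) + (m + e * m) * ((w + m) * x)            ∎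
  where
  open ≤-Reasoning
  x = (w + m) ^ e
  y = w ^ e
  lemma₁ : ∀ n x → n * x * n ≡ n * (x * n)
  lemma₁ = solve-∀
  lemma₂ : ∀ w m x y c → (w + m) * (y * (w + m) + c * x) ≡ w * y * (w + m) + (m * (y * (w + m)) + c * ((w + m) * x))
  lemma₂ = solve-∀
  lemma₃ : ∀ w m x y c → w * y * (w + m) + (m * (x * (w + m)) + c * ((w + m) * x)) ≡ w * y * (w + m) + (m + c) * ((w + m) * x)
  lemma₃ = solve-∀

-- Multiplied by n, so that both n ^ e and the error term of order n ^ (e ∸ 1)
-- are polynomial even for e = 0.
leading-term : ∀ e {m n g} → m ≤ n → n ^ suc e ≤ g + (n ∸ m) ^ suc e →
  suc e * m * n ^ e * n ≤ g * n + suc e * m * (e * m) * n ^ e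
leading-term e {m} {n} {g} m≤n n^d≤ with n ∸ m | m∸n+n≡m m≤n
... | w | refl = begin
  c * (w + m) ^ e * (w + m)                                   ≡⟨ *-assoc c _ _ ⟩
  c * ((w + m) ^ e * (w + m))                                 ≤⟨ *-monoʳ-≤ c (^-lipschitz w m e) ⟩
  c * (w ^ e * (w + m) + e * m * (w + m) ^ e)                 ≡⟨ lemma c (w ^ e) (w + m) (e * m) ((w + m) ^ e) ⟩
  c * w ^ e * (w + m) + c * (e * m) * (w + m) ^ e             ≤⟨ +-monoˡ-≤ _ (*-monoˡ-≤ (w + m) cw≤g) ⟩
  g * (w + m) + c * (e * m) * (w + m) ^ e                     ∎
  where
  open ≤-Reasoning
  c = suc e * m
  -- Bernoulli's inequality with `n = w + m`, after cancelling `w ^ suc e`.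
  cw≤g : c * w ^ e ≤ g
  cw≤g = +-cancelˡ-≤ (w ^ suc e) _ _ (≤-trans (^-bernoulli w m e) (≤-trans n^d≤ (≤-reflexive (+-comm g _))))
  lemma : ∀ c y n a x → c * (y * n + a * x) ≡ c * y * n + c * a * x
  lemma = solve-∀

-- Rational bounds and the lower limit

/-≤-intro : ∀ {r : ℚ} {a b} .{{_ : NonZero b}} → ↥ r ℤ.* + b ℤ.≤ + a ℤ.* ↧ r → r ℚ.≤ + a / b
/-≤-intro {mkℚ _ _ _} {a} {suc b} le =
  ℚ.toℚᵘ-cancel-≤ (ℚᵘ.≤-respʳ-≃ (ℚᵘ.≃-sym (ℚ.toℚᵘ-fromℚᵘ (ℚᵘ.mkℚᵘ (+ a) b))) (ℚᵘ.*≤* le))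

/-≤-/ : ∀ {a b x} .{{_ : NonZero b}} → a ≤ x * b → + a / b ℚ.≤ + x / 1
/-≤-/ {a} {suc b} {x} le = ℚ.toℚᵘ-cancel-≤
  (ℚᵘ.≤-respˡ-≃ (ℚᵘ.≃-sym (ℚ.toℚᵘ-fromℚᵘ (ℚᵘ.mkℚᵘ (+ a) b)))
  (ℚᵘ.≤-respʳ-≃ (ℚᵘ.≃-sym (ℚ.toℚᵘ-fromℚᵘ (ℚᵘ.mkℚᵘ (+ x) 0)))
  (ℚᵘ.*≤* (subst₂ ℤ._≤_ (ℤ.pos-* a 1) (ℤ.pos-* x (suc b))
    (ℤ.+≤+ (≤-trans (≤-reflexive (*-identityʳ a)) le))))))

<-/-elim : ∀ {r : ℚ} x → r ℚ.< + x / 1 → ↥ r ℤ.< + x ℤ.* ↧ r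
<-/-elim {r@record{}} x r<x
  with ℚᵘ.*<* lt ← ℚᵘ.<-respʳ-≃ (ℚ.toℚᵘ-fromℚᵘ (ℚᵘ.mkℚᵘ (+ x) 0)) (ℚ.toℚᵘ-mono-< r<x) =
  subst (ℤ._< + x ℤ.* ↧ r) (ℤ.*-identityʳ (↥ r)) lt

-- The numbers are integers, so `u < c * v` leaves a slack of at least one. Multiplied by `y * n`,
-- this absorbs the error term as soon as `n` is at least its coefficient `v * (c * (e * m))`.
below-leading-term : ∀ e {m n g u v} .{{_ : NonZero n}} →
  m + v * (suc e * m * (e * m)) ≤ n → n ^ suc e ≤ g + (n ∸ m) ^ suc e →
  u < suc e * m * v → u * n ^ e ≤ g * v
below-leading-term e {m} {n} {g} {u} {v} N≤n n^d≤ u<cv = *-cancelʳ-≤ _ _ n (+-cancelʳ-≤ (n * y) _ _ (begin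
  u * y * n + n * y              ≡⟨ lemma₁ u y n ⟩
  suc u * (y * n)                ≤⟨ *-monoˡ-≤ (y * n) u<cv ⟩
  c * v * (y * n)                ≡⟨ lemma₂ c v y n ⟩
  v * (c * y * n)                ≤⟨ *-monoʳ-≤ v (leading-term e (m+n≤o⇒m≤o m N≤n) n^d≤) ⟩
  v * (g * n + c * (e * m) * y)  ≡⟨ lemma₃ v g n (c * (e * m)) y ⟩
  g * v * n + v * (c * (e * m)) * y
    ≤⟨ +-monoʳ-≤ (g * v * n) (*-monoˡ-≤ y (m+n≤o⇒n≤o m N≤n)) ⟩
  g * v * n + n * y              ∎))
  where
  open ≤-Reasoning
  y = n ^ e
  c = suc e * m
  lemma₁ : ∀ u y n → u * y * n + n * y ≡ suc u * (y * n)
  lemma₁ = solve-∀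
  lemma₂ : ∀ c v y n → c * v * (y * n) ≡ v * (c * y * n)
  lemma₂ = solve-∀
  lemma₃ : ∀ v g n c y → v * (g * n + c * y) ≡ g * v * n + v * c * y
  lemma₃ = solve-∀

eventually-≥ : ∀ e m (g : ℕ → ℕ) → (∀ n → n ^ suc e ≤ g n + (n ∸ m) ^ suc e) →
  ∀ r → r ℚ.< + (suc e * m) / 1 →
  ∃ λ N → ∀ n .{{_ : NonZero n}} → N ≤ n → r ℚ.≤ _/_ (+ g n) (n ^ e) {{m^n≢0 n e}}
-- A negative `r` lies below every term, so the threshold is 0.
eventually-≥ e m g n^d≤ (mkℚ -[1+ u ] v _) r<x =
  0 , λ n _ → /-≤-intro {a = g n} {b = n ^ e} {{m^n≢0 n e}}
    (ℤ.≤-trans (ℤ.*-monoʳ-≤-nonNeg (+ (n ^ e)) {x = -[1+ u ]} {y = + 0} ℤ.-≤+)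
      (subst (+ 0 ℤ.≤_) (ℤ.pos-* (g n) (suc v)) (ℤ.+≤+ z≤n)))
-- The denominator of `r` is `suc v`. The threshold is `m`, which makes `n ∸ m` exact, plus the
-- coefficient of the error term.
eventually-≥ e m g n^d≤ (mkℚ (+ u) v _) r<x =
  m + suc v * (suc e * m * (e * m)) , λ n N≤n → /-≤-intro {a = g n} {b = n ^ e} {{m^n≢0 n e}}
    (subst₂ ℤ._≤_ (ℤ.pos-* u (n ^ e)) (ℤ.pos-* (g n) (suc v))
      (ℤ.+≤+ (below-leading-term e {m} {n} {g n} {u} {suc v} N≤n (n^d≤ n) u<xv)))
  where
  u<xv : u < suc e * m * suc v
  u<xv = ℤ.drop‿+<+ (subst (+ u ℤ.<_) (sym (ℤ.pos-* (suc e * m) (suc v))) (<-/-elim (suc e * m) r<x))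

-- Serves permutation matrices, tuple permutation matrices and the identity alike.
I-lower : ∀ {e} {ks : Vec ℕ (suc e)} (P : Matrix ks) (p : Index ks) → P p ≡ true →
  (∀ ℓ → m < lookup ks ℓ) → I P ≥ᴸ + (suc e * m) / 1
I-lower {m} {e} P p Pp m<ks q q<x =
  -- The lower cut asks for a rational strictly above `q` that bounds the sequence; density supplies
  -- one below the limit.
  let r , q<r , r<x = ℚ.<-dense q<x in
  r , q<r , eventually-≥ e m (λ n → f n P) (f-lower {m = m} P p Pp m<ks) r r<x

-- Upper bound

-- Entry `i` becomes `g (i + 1)`, and `x` fills the last place.
shift : {X : Set} → X → (Fin n → X) → Fin n → X
shift {suc zero}    x g zero    = x
shift {suc (suc n)} x g zero    = g (suc zero)
shift {suc (suc n)} x g (suc i) = shift x (g ∘ suc) i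

-- The value at `g zero` leaves and that at `x` enters. The function `F` allows the entries to be
-- whole slices, with `F = total`.
sum-shift : {X : Set} (F : X → ℕ) (x : X) (g : Fin (suc n) → X) →
  sum (F ∘ shift x g) + F (g zero) ≡ sum (F ∘ g) + F x
sum-shift {zero}  F x g = lemma (F x) (F (g zero))
  where
  lemma : ∀ a b → a + 0 + b ≡ b + 0 + a
  lemma = solve-∀
sum-shift {suc n} F x g = begin
  b + U + a     ≡⟨ lemma a b U ⟩
  a + (U + b)   ≡⟨ cong (_+_ a) (sum-shift F x (g ∘ suc)) ⟩
  a + (T + F x) ≡⟨ +-assoc a T (F x) ⟨
  a + T + F x   ∎
  where
  open ≡-Reasoning
  a = F (g zero)
  b = F (g (suc zero))
  U = sum (F ∘ shift x (g ∘ suc))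
  T = sum (F ∘ g ∘ suc)
  lemma : ∀ a b s → b + s + a ≡ a + (s + b)
  lemma = solve-∀

shift-view : {X : Set} (x : X) (g : Fin n → X) (i : Fin n) →
  shift x g i ≡ x ⊎ ∃ λ j → toℕ i < toℕ j × shift x g i ≡ g j
shift-view {suc zero}    x g zero    = inj₁ refl
shift-view {suc (suc n)} x g zero    = inj₂ (suc zero , z<s , refl)
shift-view {suc (suc n)} x g (suc i) with shift-view x (g ∘ suc) i
... | inj₁ eq             = inj₁ eq
... | inj₂ (j , i<j , eq) = inj₂ (suc j , s≤s i<j , eq)

infix 4 _≺_ _≼ⁱ_

_≺_ _≼ⁱ_ : Index ns → Index ns → Set
i ≺ j  = ∀ ℓ → toℕ (coord i ℓ) < toℕ (coord j ℓ)
i ≼ⁱ j = ∀ ℓ → toℕ (coord i ℓ) ≤ toℕ (coord j ℓ)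

-- The value at the next index i + (1, …, 1) of the diagonal, or 0 outside.
advance : (Index ns → ℕ) → Index ns → ℕ
advance {ns = []}     g is       = g is
advance {ns = n ∷ ns} g (i ∷ is) = shift (λ _ → 0) (λ i → advance λ is → g (i ∷ is)) i is

-- Of `j = i + (1, …, 1)` only `i ≺ j` is recorded, which is all that the order of ones on a
-- diagonal requires.
advance-view : (g : Index ns → ℕ) (i : Index ns) →
  advance g i ≡ 0 ⊎ ∃ λ j → i ≺ j × advance g i ≡ g j
advance-view {ns = []}     g []       = inj₂ ([] , (λ ()) , refl)
advance-view {ns = n ∷ ns} g (i ∷ is)
  with shift-view (λ _ → 0) (λ i → advance λ is → g (i ∷ is)) i
... | inj₁ eq = inj₁ (cong-app eq is)
... | inj₂ (j , i<j , eq) with advance-view (λ is → g (j ∷ is)) is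
...   | inj₁ eq′ = inj₁ (trans (cong-app eq is) eq′)
...   | inj₂ (js , is≺js , eq′) =
  inj₂ (j ∷ js , (λ { zero → i<j ; (suc ℓ) → is≺js ℓ }) , trans (cong-app eq is) eq′)

advance-≤ : {g : Index ns → ℕ} → (∀ i → g i ≤ m) → ∀ i → advance g i ≤ m
advance-≤ {g = g} g≤m i with advance-view g i
... | inj₁ eq           = ≤-trans (≤-reflexive eq) z≤n
... | inj₂ (j , _ , eq) = ≤-trans (≤-reflexive eq) (g≤m j)

-- An upper bound for the number of indices with some coordinate zero, where
-- the diagonals start.
surface : Vec ℕ d → ℕ
surface []       = 0
surface (n ∷ ns) = n * surface ns + volume ns

surface-replicate : ∀ e n → surface (replicate (suc e) n) ≡ suc e * n ^ e
surface-replicate zero    n = cong (_+ 1) (*-zeroʳ n)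
surface-replicate (suc e) n = begin
  n * surface (replicate (suc e) n) + volume (replicate (suc e) n)
    ≡⟨ cong₂ _+_ (cong (n *_) (surface-replicate e n)) (volume-replicate (suc e) n) ⟩
  n * (suc e * n ^ e) + n * n ^ e
    ≡⟨ lemma n (suc e) (n ^ e) ⟩
  n * n ^ e + suc e * (n * n ^ e) ∎
  where
  open ≡-Reasoning
  lemma : ∀ n c x → n * (c * x) + n * x ≡ n * x + c * (n * x)
  lemma = solve-∀

-- Induction on the dimension: advancing within each slice loses at most `m * surface ns`, and
-- moving the slices by one drops the slice at zero, which is worth at most `m * volume ns`.
total-advance : {g : Index ns → ℕ} → (∀ i → g i ≤ m) →
  total g ≤ total (advance g) + m * surface ns
total-advance {ns = []}             g≤m = m≤m+n _ _
total-advance {ns = zero ∷ ns}      g≤m = z≤n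
total-advance {ns = n@(suc _) ∷ ns} {m = m} {g = g} g≤m = begin
  sum {n} (λ i → total (slice i))
    ≤⟨ sum-mono (λ i → total-advance λ is → g≤m (i ∷ is)) ⟩
  sum {n} (λ i → total (advance (slice i)) + m * surface ns)
    ≡⟨ ∑-distrib-+ {n} (total ∘ advance ∘ slice) (λ _ → m * surface ns) ⟩
  sum (total ∘ advance ∘ slice) + sum {n} (λ _ → m * surface ns)
    -- The total of the zero function is the slice that enters at the end in `sum-shift`.
    ≤⟨ +-mono-≤ (m≤m+n (sum (total ∘ advance ∘ slice)) (total {ns = ns} λ _ → 0))
                (≤-reflexive (sum-const n (m * surface ns))) ⟩
  sum (total ∘ advance ∘ slice) + total {ns = ns} (λ _ → 0) + n * (m * surface ns)
    ≡⟨ cong (_+ n * (m * surface ns)) (sum-shift total (λ _ → 0) (advance ∘ slice)) ⟨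
  T + total (advance (slice zero)) + n * (m * surface ns)
    ≤⟨ +-monoˡ-≤ _ (+-monoʳ-≤ T (total-bound (advance-≤ λ is → g≤m (zero ∷ is)))) ⟩
  T + m * volume ns + n * (m * surface ns)
    ≡⟨ lemma T m (volume ns) n (surface ns) ⟩
  T + m * (n * surface ns + volume ns) ∎
  where
  open ≤-Reasoning
  slice : Fin n → Index ns → ℕ
  slice i is = g (i ∷ is)
  T = total (advance g)
  lemma : ∀ t m v n s → t + m * v + n * (m * s) ≡ t + m * (n * s + v)
  lemma = solve-∀

-- Ones of the identity matrix

diagonal : Fin k → Index (replicate d k)
diagonal {d = zero}  x = []
diagonal {d = suc d} x = x ∷ diagonal x

coord-diagonal : ∀ d (x : Fin k) ℓ → toℕ (coord (diagonal {d = d} x) ℓ) ≡ toℕ x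
coord-diagonal (suc d) x zero    = refl
coord-diagonal (suc d) x (suc ℓ) = coord-diagonal d x ℓ

diagonal-unique : ∀ d (i : Index (replicate d k)) (x : Fin k) →
  (∀ ℓ → toℕ (coord i ℓ) ≡ toℕ x) → i ≡ diagonal x
diagonal-unique zero    []       x eq = refl
diagonal-unique (suc d) (i ∷ is) x eq =
  cong₂ _∷_ (Fin.toℕ-injective (eq zero)) (diagonal-unique d is x (eq ∘ suc))

isYes-true : {P : Set} (P? : Dec P) → ⌊ P? ⌋ ≡ true → P
isYes-true (yes p) _ = p

true-isYes : {P : Set} (P? : Dec P) → P → ⌊ P? ⌋ ≡ true
true-isYes (yes _) _ = refl
true-isYes (no ¬p) p = contradiction p ¬p

identity-diagonal : ∀ d (x : Fin k) → identity d k (diagonal x) ≡ true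
identity-diagonal d x =
  true-isYes _ λ ℓ m → trans (coord-diagonal d x ℓ) (sym (coord-diagonal d x m))

-- In positive dimension the first coordinate names the place on the diagonal.
identity-true : ∀ d i → identity (suc d) k i ≡ true → ∃ λ x → i ≡ diagonal x
identity-true d (i ∷ is) eq =
  i , diagonal-unique (suc d) (i ∷ is) i λ ℓ → isYes-true _ eq ℓ zero

-- Building copies of identity matrices

-- As all values of `s` lie beyond `j`, `s` skips everything up to `j`; its skip at `j` is turned
-- into a keep.
insert : (j : Fin n) (s : k ⊑ n) → (∀ x → toℕ j < toℕ (select s x)) →
  Σ (suc k ⊑ n) λ t → select t zero ≡ j × (∀ x → select t (suc x) ≡ select s x)
insert zero    (keep s) j<s with () ← j<s zero
insert zero    (skip s) j<s = keep s , refl , λ _ → refl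
insert (suc j) (keep s) j<s with () ← j<s zero
insert (suc j) (skip s) j<s with insert j s (s<s⁻¹ ∘ j<s)
... | t , t₀ , t₊ = skip t , cong suc t₀ , cong suc ∘ t₊

insertIndex : {ns : Vec ℕ d} (j : Index ns) (ss : Selection (replicate d k) ns) →
  (∀ x → j ≺ selectIndex ss (diagonal x)) →
  Σ (Selection (replicate d (suc k)) ns) λ ts →
    selectIndex ts (diagonal zero) ≡ j ×
    (∀ x → selectIndex ts (diagonal (suc x)) ≡ selectIndex ss (diagonal x))
insertIndex []       []       j≺ss = [] , refl , λ _ → refl
insertIndex (j ∷ js) (s ∷ ss) j≺ss
  with insert j s (λ x → j≺ss x zero) | insertIndex js ss (λ x → j≺ss x ∘ suc)
... | t , t₀ , t₊ | ts , ts₀ , ts₊ = t ∷ ts , cong₂ _∷_ t₀ ts₀ , λ x → cong₂ _∷_ (t₊ x) (ts₊ x)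

none : ∀ n → 0 ⊑ n
none zero    = done
none (suc n) = skip (none n)

noneIndex : (ns : Vec ℕ d) → Selection (replicate d 0) ns
noneIndex []       = []
noneIndex (n ∷ ns) = none n ∷ noneIndex ns

-- A copy of the v × ⋯ × v identity matrix in A; Q constrains all coordinates
-- of its ones but the first.
Chain : {ns : Vec ℕ d} → Matrix (n ∷ ns) → ℕ → (Index ns → Set) → Set
Chain {d} {n} {ns} A v Q = Σ (v ⊑ n) λ s → Σ (Selection (replicate d v) ns) λ ss → ∀ x →
  A (select s x ∷ selectIndex ss (diagonal x)) ≡ true × Q (selectIndex ss (diagonal x))

-- All ones of the identity are on the diagonal, so the chain accounts for each of them.
chain⇒contains : {ns : Vec ℕ d} (A : Matrix (n ∷ ns)) (Q : Index ns → Set) →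
  Chain A k Q → Contains A (identity (suc d) k)
chain⇒contains {d} {k = k} A Q (s , ss , chain) = s ∷ ss , below
  where
  below : identity (suc d) k ≼ submatrix (s ∷ ss) A
  below i with identity (suc d) k i in eq
  ... | false = Bool.≤-minimum _
  ... | true with identity-true d i eq
  ...   | x , refl = Bool.≤-reflexive (sym (proj₁ (chain x)))

emptyChain : (A : Matrix (n ∷ ns)) (Q : Index ns → Set) → Chain A 0 Q
emptyChain {n = n} {ns = ns} A Q = none n , noneIndex ns , λ ()

tailSlices : Matrix (suc n ∷ ns) → Matrix (n ∷ ns)
tailSlices A (i ∷ is) = A (suc i ∷ is)

skipSlice : (A : Matrix (suc n ∷ ns)) (Q : Index ns → Set) → Chain (tailSlices A) k Q → Chain A k Q
skipSlice A Q (s , ss , chain) = skip s , ss , chain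

weakenChain : (A : Matrix (n ∷ ns)) (i : Index ns) → Chain A k (i ≺_) → Chain A k (i ≼ⁱ_)
weakenChain A i (s , ss , chain) = s , ss , λ x → proj₁ (chain x) , λ ℓ → <⇒≤ (proj₂ (chain x) ℓ)

-- Gains the strict bound that `extendChain` needs in order to place a one at `i` in front.
lowerChain : (A : Matrix (n ∷ ns)) (i j : Index ns) → i ≺ j → Chain A k (j ≼ⁱ_) → Chain A k (i ≺_)
lowerChain A i j i≺j (s , ss , chain) =
  s , ss , λ x → proj₁ (chain x) , λ ℓ → <-≤-trans (i≺j ℓ) (proj₂ (chain x) ℓ)

extendChain : (A : Matrix (suc n ∷ ns)) (i : Index ns) → A (zero ∷ i) ≡ true →
  Chain (tailSlices A) k (i ≺_) → Chain A (suc k) (i ≼ⁱ_)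
extendChain A i Ai (s , ss , chain) with insertIndex i ss (proj₂ ∘ chain)
... | ts , ts₀ , ts₊ = keep s , ts , λ where
  zero    → trans (cong (λ j → A (zero ∷ j)) ts₀) Ai ,
            subst (i ≼ⁱ_) (sym ts₀) (λ ℓ → ≤-refl)
  (suc x) → trans (cong (λ j → A (suc (select s x) ∷ j)) (ts₊ x)) (proj₁ (chain x)) ,
            subst (i ≼ⁱ_) (sym (ts₊ x)) (<⇒≤ ∘ proj₂ (chain x))

-- The number of ones of A on the diagonal that starts at (0, j).
height : Matrix (n ∷ ns) → Index ns → ℕ
height {zero}  A j = 0
height {suc n} A j = indicator (A (zero ∷ j)) + advance (height (tailSlices A)) j

-- The ones on a diagonal increase in every coordinate together, so they form a copy of an identity
-- matrix.
height-chain : (A : Matrix (n ∷ ns)) (j : Index ns) → Chain A (height A j) (j ≼ⁱ_)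
height-chain {zero}  A j = emptyChain A (j ≼ⁱ_)
height-chain {suc n} A j = step (A (zero ∷ j)) refl
  where
  next : Chain (tailSlices A) (advance (height (tailSlices A)) j) (j ≺_)
  next with advance-view (height (tailSlices A)) j
  -- The default value 0 outside the cube matches the empty chain.
  ... | inj₁ eq = subst (λ v → Chain (tailSlices A) v (j ≺_)) (sym eq) (emptyChain (tailSlices A) (j ≺_))
  ... | inj₂ (j′ , j≺j′ , eq) = subst (λ v → Chain (tailSlices A) v (j ≺_)) (sym eq)
    (lowerChain (tailSlices A) j j′ j≺j′ (height-chain (tailSlices A) j′))
  step : ∀ b → A (zero ∷ j) ≡ b →
    Chain A (indicator b + advance (height (tailSlices A)) j) (j ≼ⁱ_)
  step false _  = skipSlice A (j ≼ⁱ_) (weakenChain (tailSlices A) j next)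
  step true  Aj = extendChain A j Aj next

tailSlices-avoids : {ns : Vec ℕ d} {ks : Vec ℕ (suc d)} (A : Matrix (suc n ∷ ns)) {B : Matrix ks} →
  Avoids A B → Avoids (tailSlices A) B
tailSlices-avoids A avoids (s ∷ ss , B≼) = avoids (skip s ∷ ss , λ { (i ∷ is) → B≼ (i ∷ is) })

-- By induction the tail contributes at most `m`, so the height is at most `m + 1`. Only a chain of
-- exactly the forbidden length has to be excluded, and no chain is ever shortened.
height-≤ : {ns : Vec ℕ d} (A : Matrix (n ∷ ns)) → Avoids A (identity (suc d) (suc m)) →
  ∀ j → height A j ≤ m
height-≤ {n = zero}  A avoids j = z≤n
height-≤ {n = suc n} {m = m} A avoids j with m≤n⇒m<n∨m≡n bound
  where
  indicator-≤1 : ∀ b → indicator b ≤ 1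
  indicator-≤1 false = z≤n
  indicator-≤1 true  = ≤-refl
  bound : height A j ≤ suc m
  bound = +-mono-≤ (indicator-≤1 (A (zero ∷ j)))
    (advance-≤ (height-≤ (tailSlices A) (tailSlices-avoids A avoids)) j)
... | inj₁ h<1+m = s≤s⁻¹ h<1+m
... | inj₂ h≡1+m = contradiction
  (chain⇒contains A (j ≼ⁱ_) (subst (λ v → Chain A v (j ≼ⁱ_)) h≡1+m (height-chain A j))) avoids

-- Telescoping over the slices: the heights of the tail are advanced before those of the next slice
-- are formed, at a cost of at most `m * surface ns` each time.
ones-height : {ns : Vec ℕ d} (A : Matrix (n ∷ ns)) → Avoids A (identity (suc d) (suc m)) →
  ones A ≤ total (height A) + n * (m * surface ns)
ones-height {n = zero}  A avoids = z≤n
ones-height {n = suc n} {m = m} {ns = ns} A avoids = begin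
  ones A₀ + ones (tailSlices A)
    ≤⟨ +-monoʳ-≤ (ones A₀) (ones-height (tailSlices A) tail-avoids) ⟩
  ones A₀ + (total h + n * b)
    ≤⟨ +-monoʳ-≤ (ones A₀) (+-monoˡ-≤ (n * b) (total-advance (height-≤ (tailSlices A) tail-avoids))) ⟩
  ones A₀ + (total (advance h) + b + n * b)
    ≡⟨ cong (_+ (total (advance h) + b + n * b)) (ones≡total A₀) ⟩
  total (indicator ∘ A₀) + (total (advance h) + b + n * b)
    ≡⟨ lemma (total (indicator ∘ A₀)) (total (advance h)) b (n * b) ⟩
  total (indicator ∘ A₀) + total (advance h) + (b + n * b)
    ≡⟨ cong (_+ (b + n * b)) (total-+ (indicator ∘ A₀) (advance h)) ⟨
  total (height A) + (b + n * b) ∎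
  where
  open ≤-Reasoning
  A₀ = λ is → A (zero ∷ is)
  h = height (tailSlices A)
  b = m * surface ns
  tail-avoids = tailSlices-avoids A avoids
  lemma : ∀ x y b c → x + (y + b + c) ≡ x + y + (b + c)
  lemma = solve-∀

f-identity-upper : ∀ e m n → f n (identity (suc e) (suc m)) ≤ suc e * m * n ^ e
f-identity-upper e m n = f-least (identity (suc e) (suc m)) λ A avoids → begin
  ones A
    ≤⟨ ones-height A avoids ⟩
  total (height A) + n * (m * surface sides)
    ≤⟨ +-monoˡ-≤ _ (total-bound (height-≤ A avoids)) ⟩
  m * volume sides + n * (m * surface sides)
    -- The two terms together are `m` times the recursion for `surface (n ∷ sides)`.
    ≡⟨ lemma₁ m (volume sides) n (surface sides) ⟩
  m * surface (n ∷ sides)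
    ≡⟨ cong (m *_) (surface-replicate e n) ⟩
  m * (suc e * n ^ e)
    ≡⟨ lemma₂ m (suc e) (n ^ e) ⟩
  suc e * m * n ^ e ∎
  where
  open ≤-Reasoning
  sides = replicate e n
  lemma₁ : ∀ m v n s → m * v + n * (m * s) ≡ m * (n * s + v)
  lemma₁ = solve-∀
  lemma₂ : ∀ m d x → m * (d * x) ≡ d * m * x
  lemma₂ = solve-∀

-- Ones and sides of permutation and tuple permutation matrices

permutation-one : ∀ e m (P : Cubical (suc e) (suc m)) → IsPermutation {suc e} {suc m} P → ∃ λ p → P p ≡ true
permutation-one e m P perm with p , (_ , Pp) , _ ← perm zero zero = p , Pp

oneLarger⇒positive : (ks : Vec ℕ d) → ExactlyOneLargerThan1 ks → ∀ ℓ → 0 < lookup ks ℓ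
oneLarger⇒positive ks (ℓ₀ , >1 , ≡1) ℓ with ℓ Fin.≟ ℓ₀
... | yes refl = <-trans z<s >1
... | no  ℓ≢ℓ₀ = ≤-reflexive (sym (≡1 ℓ ℓ≢ℓ₀))

combines : {ms ns : Vec ℕ d} → Index ms → Index ns → Index (zipWith _*_ ms ns)
combines {ms = []}     {[]}     []       []       = []
combines {ms = m ∷ ms} {n ∷ ns} (i ∷ is) (j ∷ js) = combine i j ∷ combines is js

quotients-combines : {ms ns : Vec ℕ d} (i : Index ms) (j : Index ns) → quotients {ns = ns} (combines i j) ≡ i
quotients-combines {ms = []}     {[]}     []       []       = refl
quotients-combines {ms = m ∷ ms} {n ∷ ns} (i ∷ is) (j ∷ js) =
  cong₂ _∷_ (cong proj₁ (Fin.remQuot-combine i j)) (quotients-combines is js)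

tuple-one : ∀ e m {ns : Vec ℕ (suc e)} {P : Matrix ns} → IsTuplePermutation (suc m) P →
  (∃ λ p → P p ≡ true) × (∀ ℓ → m < lookup ns ℓ)
tuple-one e m (generated P′ ks perm oneLarger {P} P≗)
  with p′ , P′p′ ← permutation-one e m P′ perm =
  (p , trans (P≗ p) (cong (_∧ true) (trans (cong P′ (quotients-combines p′ r)) P′p′))) , larger
  where
  positive = oneLarger⇒positive ks oneLarger
  r : Index ks
  -- The block of `p′` consists of ones; its corner, with all remainders 0, is chosen.
  r = lookup⁻ λ ℓ → fromℕ< (positive ℓ)
  p = combines p′ r
  larger : ∀ ℓ → m < lookup (zipWith _*_ (replicate (suc e) (suc m)) ks) ℓ
  larger ℓ = subst (m <_)
    (sym (trans (Vec.lookup-zipWith _*_ ℓ (replicate (suc e) (suc m)) ks)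
                (cong (_* lookup ks ℓ) (Vec.lookup-replicate ℓ (suc m)))))
    (≤-trans (≤-reflexive (sym (*-identityʳ (suc m)))) (*-monoʳ-≤ (suc m) (positive ℓ)))

lookup-replicate-> : ∀ d m ℓ → m < lookup (replicate d (suc m)) ℓ
lookup-replicate-> d m ℓ = ≤-reflexive (sym (Vec.lookup-replicate ℓ (suc m)))

-- Limits for the identity matrix

density-identity-≤ : ∀ e m n .{{_ : NonZero n}} →
  density (identity (suc e) (suc m)) n ℚ.≤ + (suc e * m) / 1
density-identity-≤ e m n =
  /-≤-/ {f n (identity (suc e) (suc m))} {n ^ e} {suc e * m} {{m^n≢0 n e}} (f-identity-upper e m n)

I-identity-lower : ∀ e m → I (identity (suc e) (suc m)) ≥ᴸ + (suc e * m) / 1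
I-identity-lower e m = I-lower (identity (suc e) (suc m)) (diagonal zero)
  (identity-diagonal (suc e) zero) (lookup-replicate-> (suc e) m)

I-identity : ∀ e m → I (identity (suc e) (suc m)) ≈ᴸ + (suc e * m) / 1
I-identity e m q = mk⇔
  (λ (r , q<r , N , r≤) → ℚ.<-≤-trans q<r
    -- A single term past the threshold is enough; `suc N` is nonzero.
    (ℚ.≤-trans (r≤ (suc N) (n≤1+n N)) (density-identity-≤ e m (suc N))))
  (I-identity-lower e m q)

S-identity : ∀ e m → S (identity (suc e) (suc m)) ≈ᵁ + (suc e * m) / 1
S-identity e m q = mk⇔
  -- If an eventual upper bound `r` were below the limit, it would lie in the lower cut, and the
  -- terms would eventually exceed it.
  (λ (r , r<q , N , ≤r) → ℚ.≤-<-trans (ℚ.≮⇒≥ λ r<x → beyond r N ≤r (I-identity-lower e m r r<x)) r<q)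
  (λ x<q → _ , x<q , 0 , eventually)
  where
  eventually : ∀ n .{{_ : NonZero n}} → 0 ≤ n →
    density (identity (suc e) (suc m)) n ℚ.≤ + (suc e * m) / 1
  eventually n _ = density-identity-≤ e m n
  beyond : ∀ r N → (∀ n .{{_ : NonZero n}} → N ≤ n → density (identity (suc e) (suc m)) n ℚ.≤ r) →
    ¬ I (identity (suc e) (suc m)) r
  beyond r N ≤r (r′ , r<r′ , N′ , r′≤) = ℚ.<-irrefl refl (ℚ.<-≤-trans r<r′
    -- A nonzero index past both thresholds.
    (ℚ.≤-trans (r′≤ (suc (N + N′)) (m≤n⇒m≤1+n (m≤n+m N′ N)))
               (≤r  (suc (N + N′)) (m≤n⇒m≤1+n (m≤m+n N N′)))))

theorem4p5 : (d k : ℕ) .{{_ : NonZero d}} .{{_ : NonZero k}} →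
    ((P : Cubical d k) → IsPermutation {d} {k} P → I P ≥ᴸ + (d * (k ∸ 1)) / 1) ×
    ((ns : Vec ℕ d) (P : Matrix ns) → IsTuplePermutation k P → I P ≥ᴸ + (d * (k ∸ 1)) / 1) ×
    (I (identity d k) ≈ᴸ + (d * (k ∸ 1)) / 1 × S (identity d k) ≈ᵁ + (d * (k ∸ 1)) / 1)
-- With `d = suc e` and `k = suc m`, the exponent `d ∸ 1` and the factor `k ∸ 1` compute to `e` and
-- `m`.
theorem4p5 (suc e) (suc m) =
  (λ P perm → let p , Pp = permutation-one e m P perm in
    I-lower P p Pp (lookup-replicate-> (suc e) m)) ,
  (λ ns P tuple → let (p , Pp) , m<ns = tuple-one e m tuple in I-lower P p Pp m<ns) ,
  (I-identity e m , S-identity e m)
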